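{- Let $G$ and $H$ be finite abelian groups, written additively, of the same even order $k>2$, let $f:G\to H$ be semi-planar, and suppose $S(G,H;f)$ splits into two substructures $S_1$ and $S_2$ with $\mathcal{L}(0,0)\in S_1$. For $a\in G$ let $P_a^1=\{b\in H : \mathcal{L}(a,b)\in S_1\}$. Then the set $A=\{a\in G : P_0^1=P_a^1\}$ is either a subgroup of $G$ of index $2$, or $A=G$.
   Context: A function $f:G\to H$ is semi-planar if for every non-identity $a\in G$ and every $y\in H$, the equation $f(x+a)-f(x)=y$ has either $0$ or $2$ solutions $x\in G$. The incidence structure $S(G,H;f)$ has points $(x,y)\in G\times H$ and lines $\mathcal{L}(a,b)$ for $(a,b)\in G\times H$, with $(x,y)$ incident with $\mathcal{L}(a,b)$ iff $y=f(x-a)+b$. Its incidence graph is the bipartite graph on points and lines with an edge for each incident pair. $S(G,H;f)$ splits into two substructures $S_1,S_2$ if its incidence graph has exactly two connected components; $S_1,S_2$ are the incidence structures formed by the points and lines of the two components, and $\mathcal{L}(a,b)\in S_i$ means the line lies in component $S_i$. -}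

module Defs where

open import Level using (Level; _⊔_; suc)
open import Algebra.Bundles using (AbelianGroup)
import Algebra.Properties.Group as GroupProperties
open import Data.Fin.Base using (Fin; zero)
open import Data.Nat.Base using (ℕ)
open import Data.Product.Base using (Σ; _,_; proj₁)
open import Data.Product.Relation.Binary.Pointwise.NonDependent using (_×ₛ_)
open import Data.Sum.Base using (_⊎_; inj₁; inj₂)
open import Data.Sum.Relation.Binary.Pointwise using (_⊎ₛ_)
open import Function.Bundles using (Func; Inverse)
open import Relation.Binary.Bundles using (Setoid)
open import Relation.Binary.Core using (Rel; REL)
import Relation.Binary.Construct.Closure.Equivalence as EqClosure
import Relation.Binary.Construct.On as On
open import Relation.Binary.Construct.Union using (_∪_)
open import Relation.Binary.PropositionalEquality.Core using (_≡_)
import Relation.Binary.PropositionalEquality.Properties as ≡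
open import Relation.Unary using (Pred; _∈_; _≐_)

private
  variable
    a ℓ p : Level

-- Elements are counted up to the setoid equality, so quotienting amounts to
-- passing to a setoid with the same carrier and a coarser equality.
HasCardinality : Setoid a ℓ → ℕ → Set (a ⊔ ℓ)
HasCardinality S n = Inverse S (≡.setoid (Fin n))

subsetoid : (S : Setoid a ℓ) → Pred (Setoid.Carrier S) p → Setoid (a ⊔ p) ℓ
subsetoid S P = On.setoid {B = Σ (Setoid.Carrier S) P} S proj₁

module _ (G : AbelianGroup a ℓ) where

  open AbelianGroup G renaming (_∙_ to _+_; ε to 0#; _⁻¹ to -_)
  open GroupProperties group

  record IsSubgroup (A : Pred Carrier p) : Set (a ⊔ ℓ ⊔ p) where
    field
      resp-≈   : ∀ {x y} → x ≈ y → x ∈ A → y ∈ A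
      0∈       : 0# ∈ A
      +-closed : ∀ {x y} → x ∈ A → y ∈ A → (x + y) ∈ A
      -‿closed : ∀ {x} → x ∈ A → (- x) ∈ A

  cosets : {A : Pred Carrier p} → IsSubgroup A → Setoid a p
  cosets {A = A} A-sub = record
    { Carrier       = Carrier
    ; _≈_           = λ x y → (x - y) ∈ A
    ; isEquivalence = record
      { refl  = λ {x} → resp-≈ (sym (inverseʳ x)) 0∈
      ; sym   = λ {x} {y} x-y∈A → resp-≈ (⁻¹-anti-homo-// x y) (-‿closed x-y∈A)
      ; trans = λ {x} {y} {z} x-y∈A y-z∈A →
          resp-≈ (trans (sym (assoc (x - y) y (- z)))
                        (∙-congʳ (//-rightDividesˡ y x)))
                 (+-closed x-y∈A y-z∈A)
      }
    }
    where open IsSubgroup A-sub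

  HasIndex : {A : Pred Carrier p} → IsSubgroup A → ℕ → Set (a ⊔ p)
  HasIndex A-sub n = HasCardinality (cosets A-sub) n

record IncidenceStructure p ℓ₁ l ℓ₂ i : Set (suc (p ⊔ ℓ₁ ⊔ l ⊔ ℓ₂ ⊔ i)) where
  infix 4 _I_
  field
    points : Setoid p ℓ₁
    lines  : Setoid l ℓ₂

  open Setoid points using () renaming (Carrier to Point; _≈_ to _≈ₚ_) public
  open Setoid lines  using () renaming (Carrier to Line;  _≈_ to _≈ₗ_) public

  field
    _I_    : REL Point Line i
    I-resp : ∀ {x y L M} → x ≈ₚ y → L ≈ₗ M → x I L → y I M

module _ {p ℓ₁ l ℓ₂ i} (S : IncidenceStructure p ℓ₁ l ℓ₂ i) where

  open IncidenceStructure S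

  vertices : Setoid (p ⊔ l) (p ⊔ l ⊔ ℓ₁ ⊔ ℓ₂)
  vertices = points ⊎ₛ lines

  open Setoid vertices using (_≈_) renaming (Carrier to Vertex) public

  -- Each edge is listed once, from its point to its line; the equivalence
  -- closure below makes it undirected.
  data Edge : Rel Vertex (p ⊔ l ⊔ i) where
    incident : ∀ {x L} → x I L → Edge (inj₁ x) (inj₂ L)

  -- Walks in the incidence graph. Equal vertices are joined as well because
  -- the vertices are only given up to setoid equality.
  components : Setoid (p ⊔ l) (p ⊔ l ⊔ ℓ₁ ⊔ ℓ₂ ⊔ i)
  components = EqClosure.setoid (_≈_ ∪ Edge)

  -- The bijection with Fin 2 also names the two components.
  Splits : Set (p ⊔ l ⊔ ℓ₁ ⊔ ℓ₂ ⊔ i)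
  Splits = HasCardinality components 2

  substructure : Splits → Fin 2 → Pred Vertex _
  substructure split j v = Inverse.to split v ≡ j

module _ {g ℓ₁ h ℓ₂} (G : AbelianGroup g ℓ₁) (H : AbelianGroup h ℓ₂)
         (f : Func (AbelianGroup.setoid G) (AbelianGroup.setoid H)) where

  private
    module G = AbelianGroup G renaming (_∙_ to _+_; ε to 0#)
    module H = AbelianGroup H renaming (_∙_ to _+_; ε to 0#)
  open Func f using (cong) renaming (to to f⟨_⟩)

  SemiPlanar : Set (g ⊔ ℓ₁ ⊔ h ⊔ ℓ₂)
  SemiPlanar = ∀ a → a G.≉ G.0# → ∀ y →
    HasCardinality (solutions a y) 0 ⊎ HasCardinality (solutions a y) 2
    where
    solutions : G.Carrier → H.Carrier → Setoid (g ⊔ ℓ₂) ℓ₁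
    solutions a y =
      subsetoid G.setoid (λ x → (f⟨ x G.+ a ⟩ H.- f⟨ x ⟩) H.≈ y)

  S : IncidenceStructure (g ⊔ h) (ℓ₁ ⊔ ℓ₂) (g ⊔ h) (ℓ₁ ⊔ ℓ₂) ℓ₂
  S = record
    { points = G.setoid ×ₛ H.setoid
    ; lines  = G.setoid ×ₛ H.setoid
    ; _I_    = λ { (x , y) (a , b) → y H.≈ (f⟨ x G.- a ⟩ H.+ b) }
    ; I-resp = λ { (x≈x′ , y≈y′) (a≈a′ , b≈b′) y≈f⟨x-a⟩+b →
        H.trans (H.sym y≈y′)
          (H.trans y≈f⟨x-a⟩+b
            (H.∙-cong (cong (G.∙-cong x≈x′ (G.⁻¹-cong a≈a′))) b≈b′)) }
    }

  ℒ : G.Carrier → H.Carrier → Vertex S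
  ℒ a b = inj₂ (a , b)

  module _ (split : Splits S) where

    S₁ : Pred (Vertex S) _
    S₁ = substructure S split zero

    P¹ : G.Carrier → Pred H.Carrier _
    P¹ a b = ℒ a b ∈ S₁

    A : Pred G.Carrier _
    A a = P¹ G.0# ≐ P¹ a

{-# OPTIONS --safe #-}

-- The translations of G × H are automorphisms of S(G,H;f) and act regularly on
-- the lines. An automorphism permutes the components, and with two of them the
-- component of ℒ(a,b) is therefore determined by a homomorphism χ : G × H → ℤ/2.
-- Then A is the kernel of a ↦ χ(a,0), which has index 1 or 2.
module Submission where

open import Defs hiding (_≈_)
open import Algebra.Bundles using (AbelianGroup; Group)
import Algebra.Properties.Group as GroupProperties
open import Data.Fin.Base using (Fin; zero; suc)
open import Data.Fin.Properties using (_≟_; any?)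
open import Data.Nat.Base using (ℕ; _>_)
open import Data.Nat.Divisibility using (_∣_)
open import Data.Product.Base using (Σ-syntax; ∃; _×_; _,_)
open import Data.Sum.Base using (_⊎_; inj₁; inj₂)
import Data.Sum.Base as Sum
open import Data.Sum.Relation.Binary.Pointwise using (inj₁; inj₂)
open import Function.Base using (_∘_)
open import Function.Bundles using (Func; Inverse; _⇔_; mk⇔; Equivalence)
open import Function.Consequences.Setoid using (inverseʳ⇒injective)
import Relation.Binary.Construct.Closure.Equivalence as EqClosure
open import Relation.Binary.Bundles using (Setoid)
open import Relation.Binary.PropositionalEquality.Core as ≡ using (_≡_; _≢_)
import Relation.Binary.PropositionalEquality.Properties as ≡
import Relation.Binary.Reasoning.Setoid as ≈-Reasoning
open import Relation.Nullary.Decidable using (Dec; yes; no; map′)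
open import Relation.Nullary.Negation.Core using (contradiction)
open import Relation.Unary using (Pred; _∈_; _≐_; U; Decidable)

-- It suffices to test the representatives `from i`: each `x` equals `from (to x)` in the setoid,
-- and `P` respects that equality.
any-finite? : ∀ {a ℓ p} (S : Setoid a ℓ) {n} → HasCardinality S n →
  let open Setoid S in {P : Pred Carrier p} →
  (∀ {x y} → x ≈ y → x ∈ P → y ∈ P) → Decidable P → Dec (∃ P)
any-finite? S card resp P? =
  map′ (λ (i , p) → from i , p)
       (λ (x , p) → to x , resp (sym (strictlyInverseʳ x)) p)
       (any? (P? ∘ from))
  where
  open Inverse card
  open Setoid S using (sym)

≢zero⇒≡one : ∀ {i : Fin 2} → i ≢ zero → i ≡ suc zero
≢zero⇒≡one {zero}     i≢0 = contradiction ≡.refl i≢0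
≢zero⇒≡one {suc zero} _   = ≡.refl

x∙z//y∙z≈x//y : ∀ {a ℓ} (G : Group a ℓ) → let open Group G in
  ∀ x y z → (x ∙ z) // (y ∙ z) ≈ x // y
x∙z//y∙z≈x//y G x y z = begin
  (x ∙ z) ∙ (y ∙ z) ⁻¹       ≈⟨ ∙-congˡ (⁻¹-anti-homo-∙ y z) ⟩
  (x ∙ z) ∙ (z ⁻¹ ∙ y ⁻¹)    ≈⟨ assoc (x ∙ z) (z ⁻¹) (y ⁻¹) ⟨
  ((x ∙ z) ∙ z ⁻¹) ∙ y ⁻¹    ≈⟨ ∙-congʳ (//-rightDividesʳ z x) ⟩
  x ∙ y ⁻¹                   ∎
  where
  open Group G
  open GroupProperties G
  open ≈-Reasoning setoid

-- `colour` stands for the restriction of χ to G. Instead of additivity into ℤ/2, it is required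
-- that translation preserve equality of colours; this already makes the colour classes the cosets
-- of the class of `ε`.
module TwoColouring {a ℓ} (G : AbelianGroup a ℓ) where

  open AbelianGroup G
  open GroupProperties group
  open ≡.≡-Reasoning

  module _
    (colour : Carrier → Fin 2)
    (colour-cong : ∀ {x y} → x ≈ y → colour x ≡ colour y)
    (colour-translate : ∀ {x y} z → colour x ≡ colour y → colour (x ∙ z) ≡ colour (y ∙ z))
    (colour-ε : colour ε ≡ zero)
    {p} {A : Pred Carrier p} (∈A⇔ : ∀ {x} → x ∈ A ⇔ colour x ≡ zero)
    where

    private module ∈A {x} = Equivalence (∈A⇔ {x})

    -- Translating `x - y` and `ε`, which share a colour, by `y` gives `x` and `y`. With the
    -- converse below, `colour` is well defined and injective on cosets.
    -∈A⇒≡ : ∀ {x y} → (x - y) ∈ A → colour x ≡ colour y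
    -∈A⇒≡ {x} {y} x-y∈A = begin
      colour x              ≡⟨ colour-cong (//-rightDividesˡ y x) ⟨
      colour ((x - y) ∙ y)  ≡⟨ colour-translate y (≡.trans (∈A.to x-y∈A) (≡.sym colour-ε)) ⟩
      colour (ε ∙ y)        ≡⟨ colour-cong (identityˡ y) ⟩
      colour y              ∎

    ≡⇒-∈A : ∀ {x y} → colour x ≡ colour y → (x - y) ∈ A
    ≡⇒-∈A {x} {y} cx≡cy = ∈A.from (begin
      colour (x - y)  ≡⟨ colour-translate (y ⁻¹) cx≡cy ⟩
      colour (y - y)  ≡⟨ colour-cong (inverseʳ y) ⟩
      colour ε        ≡⟨ colour-ε ⟩
      zero            ∎)

    isSubgroup : IsSubgroup G A
    isSubgroup = record
      { resp-≈   = λ x≈y x∈A → ∈A.from (≡.trans (colour-cong (sym x≈y)) (∈A.to x∈A))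
      ; 0∈       = ∈A.from colour-ε
      ; +-closed = λ {x} {y} x∈A y∈A → ∈A.from (begin
          colour (x ∙ y)  ≡⟨ colour-translate y (≡.trans (∈A.to x∈A) (≡.sym colour-ε)) ⟩
          colour (ε ∙ y)  ≡⟨ colour-cong (identityˡ y) ⟩
          colour y        ≡⟨ ∈A.to y∈A ⟩
          zero            ∎)
      ; -‿closed = λ {x} x∈A → ∈A.from (begin
          colour (x ⁻¹)      ≡⟨ colour-cong (identityˡ (x ⁻¹)) ⟨
          -- Since `ε` and `x` have the same colour, their difference `ε - x` lies in `A`.
          colour (ε ∙ x ⁻¹)  ≡⟨ ∈A.to (≡⇒-∈A (≡.trans colour-ε (≡.sym (∈A.to x∈A)))) ⟩
          zero               ∎)
      }

    -- The bijection from cosets to `Fin 2` is `colour` itself; `ε` and `u` witness that both values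
    -- occur.
    hasIndex-2 : ∃ (λ x → colour x ≡ suc zero) → HasIndex G isSubgroup 2
    hasIndex-2 (u , cu≡1) = record
      { to        = colour
      ; from      = representative
      ; to-cong   = -∈A⇒≡
      ; from-cong = λ { ≡.refl → Setoid.refl (cosets G isSubgroup) }
      ; inverse   = (λ {i} y~ri → ≡.trans (-∈A⇒≡ y~ri) (colour-representative i))
                  , (λ {x} {i} i≡cx → ≡⇒-∈A (≡.trans (colour-representative i) i≡cx))
      }
      where
      representative : Fin 2 → Carrier
      representative zero       = ε
      representative (suc zero) = u

      colour-representative : ∀ i → colour (representative i) ≡ i
      colour-representative zero       = colour-ε
      colour-representative (suc zero) = cu≡1

    index-2-or-full : ∀ {n} → HasCardinality setoid n →
      (Σ[ A-sub ∈ IsSubgroup G A ] HasIndex G A-sub 2) ⊎ (A ≐ U)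
    index-2-or-full card
      -- Finiteness of the group decides whether the second colour occurs, and so which alternative
      -- holds.
      with any-finite? setoid card (λ x≈y → ≡.trans (colour-cong (sym x≈y)))
             (λ x → colour x ≟ suc zero)
    ... | yes u∈  = inj₁ (isSubgroup , hasIndex-2 u∈)
    ... | no  ∄u  = inj₂ ((λ _ → _) , λ {x} _ → full x)
      where
      full : ∀ x → x ∈ A
      full x with colour x ≟ zero
      ... | yes cx≡0 = ∈A.from cx≡0
      ... | no  cx≢0 = contradiction (x , ≢zero⇒≡one cx≢0) ∄u

module _ {g ℓ₁ h ℓ₂} (G : AbelianGroup g ℓ₁) (H : AbelianGroup h ℓ₂)
  (f : Func (AbelianGroup.setoid G) (AbelianGroup.setoid H)) where

  private
    module G = AbelianGroup G renaming (_∙_ to _+_; ε to 0#)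
    module H = AbelianGroup H renaming (_∙_ to _+_; ε to 0#)
    incidence = S G H f
    line = ℒ G H f

  translate : G.Carrier → H.Carrier → Vertex incidence → Vertex incidence
  translate c d = Sum.map shift shift
    where
    shift : G.Carrier × H.Carrier → G.Carrier × H.Carrier
    shift (x , y) = x G.+ c , y H.+ d

  -- Incidence involves `x` and `a` only through `x - a`, which a common shift by `c` leaves alone,
  -- while `d` is added to both sides of the equation.
  translate-edge : ∀ c d {v w} → Edge incidence v w →
    Edge incidence (translate c d v) (translate c d w)
  translate-edge c d (incident {x , y} {a , b} y≈) = incident (begin
    y H.+ d                                          ≈⟨ H.∙-congʳ y≈ ⟩
    (f⟨ x G.- a ⟩ H.+ b) H.+ d                       ≈⟨ H.assoc _ b d ⟩
    f⟨ x G.- a ⟩ H.+ (b H.+ d)                       ≈⟨ H.∙-congʳ (cong (x∙z//y∙z≈x//y G.group x a c)) ⟨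
    f⟨ (x G.+ c) G.- (a G.+ c) ⟩ H.+ (b H.+ d)       ∎)
    where
    open Func f renaming (to to f⟨_⟩)
    open ≈-Reasoning H.setoid

  translate-connected : ∀ c d {v w} → let open Setoid (components incidence) in
    v ≈ w → translate c d v ≈ translate c d w
  translate-connected c d = EqClosure.gmap (translate c d) λ
    { (inj₁ (inj₁ (x≈ , y≈))) → inj₁ (inj₁ (G.∙-congʳ x≈ , H.∙-congʳ y≈))
    ; (inj₁ (inj₂ (a≈ , b≈))) → inj₁ (inj₂ (G.∙-congʳ a≈ , H.∙-congʳ b≈))
    ; (inj₂ e)                → inj₂ (translate-edge c d e)
    }

  module _ (split : Splits incidence) where

    open Inverse split

    component-cong : ∀ {a a′ b b′} → a G.≈ a′ → b H.≈ b′ →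
      to (line a b) ≡ to (line a′ b′)
    component-cong a≈ b≈ = to-cong (EqClosure.return (inj₁ (inj₂ (a≈ , b≈))))

    -- Equal labels mean connected vertices, as the labelling is injective on components.
    -- Translating the connecting walk gives a walk between the images.
    component-translate : ∀ c d {v w} → to v ≡ to w →
      to (translate c d v) ≡ to (translate c d w)
    component-translate c d =
      to-cong ∘ translate-connected c d ∘
      inverseʳ⇒injective (components incidence) (≡.setoid (Fin 2)) to inverseʳ

    component-translateˡ : ∀ {a a′ b} c → to (line a b) ≡ to (line a′ b) →
      to (line (a G.+ c) b) ≡ to (line (a′ G.+ c) b)
    component-translateˡ {b = b} c eq =
      ≡.trans (component-cong G.refl (H.sym (H.identityʳ b)))
        (≡.trans (component-translate c H.0# eq)
          (component-cong G.refl (H.identityʳ b)))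

    -- Translation by `(0#, b)` carries the lines at height `0#` to those at height `b`, so one
    -- comparison at `0#` settles all of `P¹ a` and `P¹ a′`.
    component-slide : ∀ {a a′} b → to (line a H.0#) ≡ to (line a′ H.0#) →
      to (line a b) ≡ to (line a′ b)
    component-slide {a} {a′} b eq =
      ≡.trans (component-cong (G.sym (G.identityʳ a)) (H.sym (H.identityˡ b)))
        (≡.trans (component-translate G.0# b eq)
          (component-cong (G.identityʳ a′) (H.identityˡ b)))

    ∈A⇔ : line G.0# H.0# ∈ S₁ G H f split →
      ∀ {a} → a ∈ A G H f split ⇔ to (line a H.0#) ≡ zero
    -- Forwards, evaluate the inclusion at `0#`, which lies in `P¹ 0#` by hypothesis. Backwards,
    -- slide the agreement at height `0#` to every `b`.
    ∈A⇔ 0∈S₁ = mk⇔ (λ (P₀⊆Pₐ , _) → P₀⊆Pₐ 0∈S₁) λ a∈S₁ →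
      let same = ≡.trans a∈S₁ (≡.sym 0∈S₁) in
        (λ {b} → ≡.trans (component-slide b same))
      , (λ {b} → ≡.trans (≡.sym (component-slide b same)))

theorem3 : ∀ {g ℓ₁ h ℓ₂} (G : AbelianGroup g ℓ₁) (H : AbelianGroup h ℓ₂) (k : ℕ) →
    2 ∣ k → k > 2 →
    HasCardinality (AbelianGroup.setoid G) k →
    HasCardinality (AbelianGroup.setoid H) k →
    (f : Func (AbelianGroup.setoid G) (AbelianGroup.setoid H)) →
    SemiPlanar G H f →
    (split : Splits (S G H f)) →
    ℒ G H f (AbelianGroup.ε G) (AbelianGroup.ε H) ∈ S₁ G H f split →
    (Σ[ A-sub ∈ IsSubgroup G (A G H f split) ] HasIndex G A-sub 2)
    ⊎ (A G H f split ≐ U)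
theorem3 G H k _ _ |G|≡k _ f _ split 0∈S₁ =
  TwoColouring.index-2-or-full G
    -- The colour of `a` is the component of ℒ(a,0), that is, χ(a,0).
    (λ a → Inverse.to split (ℒ G H f a (AbelianGroup.ε H)))
    (λ a≈a′ → component-cong G H f split a≈a′ (AbelianGroup.refl H))
    (component-translateˡ G H f split)
    0∈S₁
    (∈A⇔ G H f split 0∈S₁)
    |G|≡k
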